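{- For every $n\ge0$, the number $e_n$ of Dyck paths with catastrophes of length $n$ equals the number $h_n$ of $1$-horizontal Dyck paths of length $n$.
   Context: A Dyck path with catastrophes of length $n$ is a sequence of $n$ steps starting and ending at altitude $0$ and never going below altitude $0$, where each step is either an up step $(1,1)$, a down step $(1,-1)$, or a catastrophe, i.e. a step from an altitude $h>1$ directly to altitude $0$. A $1$-horizontal Dyck path of length $n$ is a sequence of $n$ steps starting and ending at altitude $0$ and never going below altitude $0$, where each step is an up step $(1,1)$, a down step $(1,-1)$, or a horizontal step $(1,0)$, horizontal steps being allowed only at altitude $1$. -}

module Defs where

open import Data.Fin.Base using (Fin)
open import Data.Fin.Properties using (0↔⊥; 1↔⊤; +↔⊎)
open import Data.Empty using (⊥)
open import Data.Nat.Base using (ℕ; zero; suc; _+_; _>_; z≤n; s≤s)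
open import Data.Product.Base using (∃; _,_; proj₁)
open import Data.Sum.Base using (_⊎_; inj₁; inj₂)
open import Data.Sum.Function.Propositional using (_⊎-↔_)
open import Data.Unit.Base using (⊤; tt)
open import Function.Base using (const)
open import Function.Bundles using (_↔_; mk↔ₛ′)
open import Function.Properties.Inverse using (↔-sym; ↔-trans)
open import Relation.Binary.PropositionalEquality.Core using (_≡_; refl)

-- `Path Step n h k`: sequences of n steps leading from altitude h to
-- altitude k, where `Step i j` is the type of steps from i to j.
-- Altitudes are natural numbers, so no path goes below 0.
data Path (Step : ℕ → ℕ → Set) : ℕ → ℕ → ℕ → Set where
  []  : ∀ {h} → Path Step 0 h h
  _∷_ : ∀ {n h i k} → Step h i → Path Step n i k → Path Step (suc n) h k

data CatastropheStep : ℕ → ℕ → Set where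
  up          : ∀ {h} → CatastropheStep h (suc h)
  down        : ∀ {h} → CatastropheStep (suc h) h
  catastrophe : ∀ {h} → h > 1 → CatastropheStep h 0

data 1-HorizontalStep : ℕ → ℕ → Set where
  up         : ∀ {h} → 1-HorizontalStep h (suc h)
  down       : ∀ {h} → 1-HorizontalStep (suc h) h
  horizontal : 1-HorizontalStep 1 1

DyckPathWithCatastrophes : ℕ → Set
DyckPathWithCatastrophes n = Path CatastropheStep n 0 0

1-HorizontalDyckPath : ℕ → Set
1-HorizontalDyckPath n = Path 1-HorizontalStep n 0 0

Finite : Set → Set
Finite A = ∃ λ m → A ↔ Fin m

-- The number of elements; it depends only on A, since Fin m ↔ Fin n
-- forces m ≡ n.
cardinality : {A : Set} → Finite A → ℕ
cardinality = proj₁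

private
  finite-⊥ : Finite ⊥
  finite-⊥ = 0 , ↔-sym 0↔⊥

  finite-⊤ : Finite ⊤
  finite-⊤ = 1 , ↔-sym 1↔⊤

  finite-⊎ : {A B : Set} → Finite A → Finite B → Finite (A ⊎ B)
  finite-⊎ (m , f) (n , g) = m + n , ↔-trans (f ⊎-↔ g) (↔-sym +↔⊎)

  finite-↔ : {A B : Set} → A ↔ B → Finite B → Finite A
  finite-↔ f (n , g) = n , ↔-trans f g

  module _ {Step : ℕ → ℕ → Set} where

    empty-0 : Path Step 0 0 0 ↔ ⊤
    empty-0 = mk↔ₛ′ (const tt) (const []) (λ _ → refl) (λ { [] → refl })

    empty-suc : ∀ {h} → Path Step 0 (suc h) 0 ↔ ⊥
    empty-suc = mk↔ₛ′ (λ ()) (λ ()) (λ ()) (λ ())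

  module _ {n : ℕ} where

    P Q : ℕ → ℕ → Set
    P m h = Path CatastropheStep m h 0
    Q m h = Path 1-HorizontalStep m h 0

    P-0 : P (suc n) 0 ↔ P n 1
    P-0 = mk↔ₛ′ (λ { (up ∷ p) → p ; (catastrophe () ∷ _) }) (up ∷_)
      (λ _ → refl) (λ { (up ∷ _) → refl ; (catastrophe () ∷ _) })

    P-1 : P (suc n) 1 ↔ (P n 2 ⊎ P n 0)
    P-1 = mk↔ₛ′
      (λ { (up ∷ p) → inj₁ p ; (down ∷ p) → inj₂ p
         ; (catastrophe (s≤s ()) ∷ _) })
      (λ { (inj₁ p) → up ∷ p ; (inj₂ p) → down ∷ p })
      (λ { (inj₁ _) → refl ; (inj₂ _) → refl })
      (λ { (up ∷ _) → refl ; (down ∷ _) → refl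
         ; (catastrophe (s≤s ()) ∷ _) })

    P-2+ : ∀ {h} → P (suc n) (2 + h) ↔ (P n (3 + h) ⊎ (P n (1 + h) ⊎ P n 0))
    P-2+ = mk↔ₛ′
      (λ { (up ∷ p) → inj₁ p ; (down ∷ p) → inj₂ (inj₁ p)
         ; (catastrophe _ ∷ p) → inj₂ (inj₂ p) })
      (λ { (inj₁ p) → up ∷ p ; (inj₂ (inj₁ p)) → down ∷ p
         ; (inj₂ (inj₂ p)) → catastrophe (s≤s (s≤s z≤n)) ∷ p })
      (λ { (inj₁ _) → refl ; (inj₂ (inj₁ _)) → refl
         ; (inj₂ (inj₂ _)) → refl })
      (λ { (up ∷ _) → refl ; (down ∷ _) → refl
         ; (catastrophe (s≤s (s≤s z≤n)) ∷ _) → refl })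

    Q-0 : Q (suc n) 0 ↔ Q n 1
    Q-0 = mk↔ₛ′ (λ { (up ∷ p) → p }) (up ∷_)
      (λ _ → refl) (λ { (up ∷ _) → refl })

    Q-1 : Q (suc n) 1 ↔ (Q n 2 ⊎ (Q n 0 ⊎ Q n 1))
    Q-1 = mk↔ₛ′
      (λ { (up ∷ p) → inj₁ p ; (down ∷ p) → inj₂ (inj₁ p)
         ; (horizontal ∷ p) → inj₂ (inj₂ p) })
      (λ { (inj₁ p) → up ∷ p ; (inj₂ (inj₁ p)) → down ∷ p
         ; (inj₂ (inj₂ p)) → horizontal ∷ p })
      (λ { (inj₁ _) → refl ; (inj₂ (inj₁ _)) → refl
         ; (inj₂ (inj₂ _)) → refl })
      (λ { (up ∷ _) → refl ; (down ∷ _) → refl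
         ; (horizontal ∷ _) → refl })

    Q-2+ : ∀ {h} → Q (suc n) (2 + h) ↔ (Q n (3 + h) ⊎ Q n (1 + h))
    Q-2+ = mk↔ₛ′
      (λ { (up ∷ p) → inj₁ p ; (down ∷ p) → inj₂ p })
      (λ { (inj₁ p) → up ∷ p ; (inj₂ p) → down ∷ p })
      (λ { (inj₁ _) → refl ; (inj₂ _) → refl })
      (λ { (up ∷ _) → refl ; (down ∷ _) → refl })

catastrophe-finite : ∀ n h → Finite (Path CatastropheStep n h 0)
catastrophe-finite zero    zero          = finite-↔ empty-0 finite-⊤
catastrophe-finite zero    (suc h)       = finite-↔ empty-suc finite-⊥
catastrophe-finite (suc n) zero          = finite-↔ P-0 (catastrophe-finite n 1)
catastrophe-finite (suc n) (suc zero)    =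
  finite-↔ P-1 (finite-⊎ (catastrophe-finite n 2) (catastrophe-finite n 0))
catastrophe-finite (suc n) (suc (suc h)) =
  finite-↔ P-2+ (finite-⊎ (catastrophe-finite n (3 + h))
    (finite-⊎ (catastrophe-finite n (1 + h)) (catastrophe-finite n 0)))

1-horizontal-finite : ∀ n h → Finite (Path 1-HorizontalStep n h 0)
1-horizontal-finite zero    zero          = finite-↔ empty-0 finite-⊤
1-horizontal-finite zero    (suc h)       = finite-↔ empty-suc finite-⊥
1-horizontal-finite (suc n) zero          = finite-↔ Q-0 (1-horizontal-finite n 1)
1-horizontal-finite (suc n) (suc zero)    =
  finite-↔ Q-1 (finite-⊎ (1-horizontal-finite n 2)
    (finite-⊎ (1-horizontal-finite n 0) (1-horizontal-finite n 1)))
1-horizontal-finite (suc n) (suc (suc h)) =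
  finite-↔ Q-2+ (finite-⊎ (1-horizontal-finite n (3 + h)) (1-horizontal-finite n (1 + h)))

e : ℕ → ℕ
e n = cardinality {DyckPathWithCatastrophes n} (catastrophe-finite n 0)

h : ℕ → ℕ
h n = cardinality {1-HorizontalDyckPath n} (1-horizontal-finite n 0)

{-# OPTIONS --safe #-}

-- Let p n k and q n k count the paths of length n from altitude k down to 0
-- in the two models.  Comparing the first-step recurrences suggests
-- p n 0 = q n 0 and p n k = q n 1 + ⋯ + q n k for k ≥ 1: when the recurrences
-- of q are summed, the down step from altitude 1 contributes q n 0 = p n 0 to
-- each sum, which plays the role of the catastrophe, while the horizontal step
-- contributes the term q n 1 missing from the shifted sum.

module Submission where

open import Defs
open import Algebra.Properties.CommutativeSemigroup using (interchange)
open import Data.Nat.Base using (ℕ; zero; suc; _+_)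
open import Data.Nat.Properties using (+-assoc; +-comm; +-commutativeSemigroup)
open import Relation.Binary.PropositionalEquality
  using (_≡_; refl; sym; trans; cong; cong₂; module ≡-Reasoning)

p q : ℕ → ℕ → ℕ
p n k = cardinality (catastrophe-finite n k)
q n k = cardinality (1-horizontal-finite n k)

-- The indices are shifted by one: Σq n k = q n 1 + ⋯ + q n (k + 1).
Σq : ℕ → ℕ → ℕ
Σq n zero    = q n 1
Σq n (suc k) = q n (2 + k) + Σq n k

+-interchange : ∀ a b c d → (a + b) + (c + d) ≡ (a + c) + (b + d)
+-interchange = interchange +-commutativeSemigroup

Σq-0 : ∀ k → Σq 0 k ≡ 0
Σq-0 zero    = refl
-- The leading term `q 0 (2 + k)` reduces to `0`.
Σq-0 (suc k) = Σq-0 k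

Σq-suc-zero : ∀ n → Σq (suc n) 0 ≡ Σq n 1 + q n 0
Σq-suc-zero n = begin
  q n 2 + (q n 0 + q n 1)  ≡⟨ cong (q n 2 +_) (+-comm (q n 0) (q n 1)) ⟩
  q n 2 + (q n 1 + q n 0)  ≡⟨ +-assoc (q n 2) (q n 1) (q n 0) ⟨
  (q n 2 + q n 1) + q n 0  ∎
  where open ≡-Reasoning

-- Shaped as the recurrence of `p` from altitude `2 + k`: up, down, catastrophe.
Σq-suc-suc : ∀ n k → Σq (suc n) (suc k) ≡ Σq n (2 + k) + (Σq n k + q n 0)
Σq-suc-suc n zero = begin
  (q n 3 + q n 1) + Σq (suc n) 0      ≡⟨ cong (q n 3 + q n 1 +_) (Σq-suc-zero n) ⟩
  (q n 3 + q n 1) + (Σq n 1 + q n 0)  ≡⟨ +-interchange (q n 3) (q n 1) (Σq n 1) (q n 0) ⟩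
  (q n 3 + Σq n 1) + (q n 1 + q n 0)  ∎
  where open ≡-Reasoning
Σq-suc-suc n (suc k) = begin
  -- The up term `a` extends `Σq n (2 + k)`, the down term `b` extends `Σq n k`.
  (a + b) + Σq (suc n) (suc k)              ≡⟨ cong (a + b +_) (Σq-suc-suc n k) ⟩
  (a + b) + (Σq n (2 + k) + (Σq n k + q₀))  ≡⟨ +-interchange a b (Σq n (2 + k)) (Σq n k + q₀) ⟩
  (a + Σq n (2 + k)) + (b + (Σq n k + q₀))  ≡⟨ cong (a + Σq n (2 + k) +_) (+-assoc b (Σq n k) q₀) ⟨
  (a + Σq n (2 + k)) + ((b + Σq n k) + q₀)  ∎
  where
  open ≡-Reasoning
  a  = q n (4 + k)
  b  = q n (2 + k)
  q₀ = q n 0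

mutual
  p≡q : ∀ n → p n 0 ≡ q n 0
  p≡q zero    = refl
  -- From altitude 0 both models can only step up.
  p≡q (suc n) = p≡Σq n 0

  -- Induction on the length for all altitudes at once, since an up step raises `k`.
  p≡Σq : ∀ n k → p n (suc k) ≡ Σq n k
  p≡Σq zero    k       = sym (Σq-0 k)
  p≡Σq (suc n) zero    =
    trans (cong₂ _+_ (p≡Σq n 1) (p≡q n)) (sym (Σq-suc-zero n))
  p≡Σq (suc n) (suc k) =
    trans (cong₂ _+_ (p≡Σq n (2 + k)) (cong₂ _+_ (p≡Σq n k) (p≡q n)))
          (sym (Σq-suc-suc n k))

theorem3p1 : ∀ (n : ℕ) → e n ≡ h n
theorem3p1 = p≡q
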